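{- Let $(p_n)_{n\ge0}$ and $(q_n)_{n\ge0}$ be the sequences defined by $p_0=1$, $p_1=0$, $q_0=0$ and $$2p_{n+1}=(3n+3)q_n-2(3n+1)p_n+2p_{n-1}\quad(n\ge1),\qquad q_n=(3n+2)p_n+2q_{n-1}\quad(n\ge1).$$ Then for every $n\ge0$, $p_n$ equals the number of ordered Carlitz words of $1^3,2^3,\ldots,n^3$, and $q_n$ equals the number of ordered Carlitz words of $0^2,1^3,2^3,\ldots,n^3$.
   Context: A word of $1^3,\ldots,n^3$ is a sequence of length $3n$ in which each of $1,\ldots,n$ occurs exactly three times; a word of $0^2,1^3,\ldots,n^3$ is a sequence of length $3n+2$ in which $0$ occurs exactly twice and each of $1,\ldots,n$ occurs exactly three times. A word is Carlitz if no two adjacent entries are equal. It is ordered if the first occurrences of the symbols present appear in increasing order from left to right (for words containing $0$, this means the word begins with $0$ and the first occurrences of $1,2,\ldots,n$ appear in increasing order). For $n=0$ the words are the empty word (for $p_0$) and $00$ (not Carlitz, so $q_0=0$). -}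

module Defs where

open import Data.Nat using (ℕ; zero; suc; _≡ᵇ_; _≤ᵇ_)
open import Data.Bool using (Bool; true; false; _∧_; _∨_; not; if_then_else_)
open import Data.List using (List; []; _∷_; map; upTo)

occ : ℕ → List ℕ → ℕ
occ a []      = zero
occ a (x ∷ w) = if a ≡ᵇ x then suc (occ a w) else occ a w

memberB : ℕ → List ℕ → Bool
memberB a []      = false
memberB a (y ∷ v) = (a ≡ᵇ y) ∨ memberB a v

firstOccsFrom : List ℕ → List ℕ → List ℕ
firstOccsFrom seen []      = []
firstOccsFrom seen (x ∷ w) =
  if memberB x seen then firstOccsFrom seen w else x ∷ firstOccsFrom (x ∷ seen) w

firstOccs : List ℕ → List ℕ
firstOccs w = firstOccsFrom [] w

allB : (ℕ → Bool) → List ℕ → Bool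
allB f []      = true
allB f (x ∷ w) = f x ∧ allB f w

eqList : List ℕ → List ℕ → Bool
eqList []      []      = true
eqList (x ∷ u) (y ∷ v) = (x ≡ᵇ y) ∧ eqList u v
eqList _       _       = false

oneTo : ℕ → List ℕ
oneTo n = map suc (upTo n)

isCarlitz : List ℕ → Bool
isCarlitz []            = true
isCarlitz (x ∷ [])      = true
isCarlitz (x ∷ y ∷ w)   = not (x ≡ᵇ y) ∧ isCarlitz (y ∷ w)

isWord3 : ℕ → List ℕ → Bool
isWord3 n w = allB (λ x → (1 ≤ᵇ x) ∧ (x ≤ᵇ n)) w ∧ allB (λ i → occ i w ≡ᵇ 3) (oneTo n)

isWord03 : ℕ → List ℕ → Bool
isWord03 n w = allB (λ x → x ≤ᵇ n) w ∧ (occ 0 w ≡ᵇ 2) ∧ allB (λ i → occ i w ≡ᵇ 3) (oneTo n)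

isOrdered : ℕ → List ℕ → Bool
isOrdered n w = eqList (firstOccs w) (oneTo n)

isOrdered0 : ℕ → List ℕ → Bool
isOrdered0 n []      = false
isOrdered0 n (x ∷ w) = (x ≡ᵇ 0) ∧ eqList (firstOccs (x ∷ w)) (0 ∷ oneTo n)

OrderedCarlitzWord : ℕ → List ℕ → Bool
OrderedCarlitzWord n w = isWord3 n w ∧ isCarlitz w ∧ isOrdered n w

OrderedCarlitzWord0 : ℕ → List ℕ → Bool
OrderedCarlitzWord0 n w = isWord03 n w ∧ isCarlitz w ∧ isOrdered0 n w

{-# OPTIONS --safe #-}
module Submission where

-- Read a word from left to right, remembering how many copies of each used
-- letter are still to come.  If i used letters have one copy left, j have two,
-- and k letters are unused, let G i j k be the number of completions when the
-- previous letter has no copies left.  Adjacency only forbids repeating the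
-- previous letter, so the general count is G minus one correction term, and G
-- satisfies a recursion in which p n = G 0 0 n and q n = G 1 0 n - G 0 0 n.
--
-- That recursion is integration by parts for
--   G i j k = ∫₀^∞ e^(-x) x^i S^j R^k / k! dx,  S = x²/2 - x,  R = x³/6 - x² + x,
-- so relations between x, S, R become linear relations for G, provable by
-- induction: x² = 2S + 2x (G-square) and xS = 3R + 4S + x (G-mixed).  Together
-- they give both recurrences.

open import Defs
open import Data.Nat using (ℕ; zero; suc; _≤_; _<_; z≤n; s≤s; _≡ᵇ_; _<ᵇ_; _≤ᵇ_; _≟_; _≤?_; _<?_) renaming (_+_ to _+ℕ_; _*_ to _*ℕ_)
open import Data.Nat.Properties using (≤-refl; ≤-reflexive; <-irrefl; <⇒≢; <⇒≤; <⇒≱; ≤⇒≯; ≰⇒>; <-≤-trans; ≤-<-trans; ≤-trans; m≤m+n; m<n⇒m<1+n; m<1+n⇒m<n∨m≡n; m≤n⇒m<n∨m≡n; n<1+n; ≡ᵇ⇒≡; ≡⇒≡ᵇ; <ᵇ⇒<; <⇒<ᵇ; ≤ᵇ⇒≤; ≤⇒≤ᵇ; +-suc; +-identityʳ; +-commutativeSemigroup; suc-injective; 1+n≢0; ≮⇒≥; m+n≡0⇒m≡0; m+n≡0⇒n≡0)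
open import Data.Integer using (ℤ; +_; _+_; _-_; _*_)
open import Data.Integer.Properties using (*-cancelˡ-≡; pos-+; pos-*)
open import Data.Integer.Tactic.RingSolver using (solve-∀)
open import Data.Fin using (Fin; zero; suc)
open import Data.List using (List; []; _∷_; _++_; map; length; lookup; applyUpTo)
open import Data.List.Properties using (length-++; length-map; ∷-injective; map-upTo)
open import Data.List.Membership.Propositional using (_∈_)
open import Data.List.Membership.Propositional.Properties using (∈-map⁺; ∈-map⁻; ∈-++⁺ˡ; ∈-++⁺ʳ; ∈-++⁻; ∈-lookup)
open import Data.List.Relation.Unary.All as All using ([]; _∷_)
open import Data.List.Relation.Unary.AllPairs using ([]; _∷_)
open import Data.List.Relation.Unary.Any as Any using (here)
open import Data.List.Relation.Unary.Any.Properties using (lookup-index)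
open import Data.List.Relation.Unary.Unique.Propositional using (Unique)
open import Data.List.Relation.Unary.Unique.Propositional.Properties using (map⁺; ++⁺)
open import Data.Bool using (Bool; true; false; T; if_then_else_; not; _∧_; _∨_)
open import Data.Bool.Properties using (T-∧; T-∨; T-≡; T-irrelevant)
open import Data.Empty using (⊥; ⊥-elim)
open import Data.Product using (Σ; ∃; _×_; _,_; proj₁; proj₂)
open import Data.Sum using (_⊎_; inj₁; inj₂)
open import Function using (_∘_; id)
open import Function.Bundles using (_↔_; mk↔ₛ′; _⇔_; mk⇔; Equivalence)
open import Relation.Nullary using (¬_; yes; no; contradiction)
open import Relation.Binary.PropositionalEquality using (_≡_; _≢_; refl; sym; trans; cong; cong₂; subst; module ≡-Reasoning)
open import Algebra.Properties.CommutativeSemigroup +-commutativeSemigroup using (x∙yz≈y∙xz)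

open Equivalence using (to; from)

-- The recursion for the completion counts.

isZero : ℕ → ℕ → ℕ → ℤ
isZero zero zero zero = + 1
isZero _    _    _    = + 0

-- viaOne, viaTwo and viaFresh count the completions that start with a given
-- letter having one copy left, with a given letter having two copies left, and
-- with the next unused letter.
opaque
  G : ℕ → ℕ → ℕ → ℤ
  viaOne viaTwo viaFresh : ℕ → ℕ → ℕ → ℤ
  G i j k = isZero i j k + + i * viaOne i j k + + j * viaTwo i j k + viaFresh i j k
  viaOne zero    j k = + 0
  viaOne (suc i) j k = G i j k
  viaTwo i zero    k = + 0
  viaTwo i (suc j) k = G (suc i) j k - G i j k
  viaFresh i j zero    = + 0
  viaFresh i j (suc k) = G i (suc j) k - (G (suc i) j k - G i j k)

opaque
  unfolding G

  -- With `G` opaque, its values stay atoms for `rewrite` and the ring solver; later proofs use only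
  -- the equations exported here.
  G-unfold : ∀ i j k → G i j k ≡ isZero i j k + + i * viaOne i j k + + j * viaTwo i j k + viaFresh i j k
  G-unfold i j k = refl

  viaOne-suc : ∀ i j k → viaOne (suc i) j k ≡ G i j k
  viaOne-suc i j k = refl

  viaTwo-suc : ∀ i j k → viaTwo i (suc j) k ≡ G (suc i) j k - G i j k
  viaTwo-suc i j k = refl

  viaFresh-zero : ∀ i j → viaFresh i j 0 ≡ + 0
  viaFresh-zero i j = refl

  viaFresh-suc : ∀ i j k → viaFresh i j (suc k) ≡ G i (suc j) k - (G (suc i) j k - G i j k)
  viaFresh-suc i j k = refl

  G-000 : G 0 0 0 ≡ + 1
  G-000 = refl

  G-001 : G 0 0 1 ≡ + 0
  G-001 = refl

  G-100 : G 1 0 0 ≡ + 1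
  G-100 = refl

G-suc₁ : ∀ i j k → G (suc i) j k ≡ (+ 1 + + i) * G i j k + + j * viaTwo (suc i) j k + viaFresh (suc i) j k
G-suc₁ i j k rewrite G-unfold (suc i) j k | viaOne-suc i j k = lem (+ i) (G i j k) (+ j * viaTwo (suc i) j k) (viaFresh (suc i) j k)
  where
  lem : ∀ i g b c → + 0 + (+ 1 + i) * g + b + c ≡ (+ 1 + i) * g + b + c
  lem = solve-∀

isZero-suc₂ : ∀ i j k → isZero i (suc j) k ≡ + 0
isZero-suc₂ zero    j k = refl
isZero-suc₂ (suc i) j k = refl

isZero-suc₃ : ∀ i j k → isZero i j (suc k) ≡ + 0
isZero-suc₃ zero    zero    k = refl
isZero-suc₃ zero    (suc j) k = refl
isZero-suc₃ (suc i) j       k = refl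

G-suc₂ : ∀ i j k → G i (suc j) k ≡ + i * viaOne i (suc j) k + (+ 1 + + j) * (G (suc i) j k - G i j k) + viaFresh i (suc j) k
G-suc₂ i j k rewrite G-unfold i (suc j) k | viaTwo-suc i j k | isZero-suc₂ i j k 
  = lem (+ j) (+ i * viaOne i (suc j) k) (G (suc i) j k - G i j k) (viaFresh i (suc j) k)
  where
  lem : ∀ j a d c → + 0 + a + (+ 1 + j) * d + c ≡ a + (+ 1 + j) * d + c
  lem = solve-∀

G-suc₃ : ∀ i j k → G i j (suc k)
  ≡ + i * viaOne i j (suc k) + + j * viaTwo i j (suc k) + (G i (suc j) k - (G (suc i) j k - G i j k))
G-suc₃ i j k rewrite G-unfold i j (suc k) | viaFresh-suc i j k | isZero-suc₃ i j k 
  = lem (+ i * viaOne i j (suc k)) (+ j * viaTwo i j (suc k)) (G i (suc j) k - (G (suc i) j k - G i j k))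
  where
  lem : ∀ a b c → + 0 + a + b + c ≡ a + b + c
  lem = solve-∀

-- Linear relations between the completion counts.

-- The product rule splits the derivative of x^(i+2) S^j R^k / k! into three terms, one for each
-- auxiliary lemma below. These call the relation only at triples that are smaller in `k`, then `j`,
-- then `i`, so the mutual recursion ends.
G-square : ∀ i j k → G (2 +ℕ i) j k ≡ + 2 * G i (suc j) k + + 2 * G (suc i) j k

private
  -- Differentiate x^(i+2) = 2 x^i S + 2 x^(i+1): the terms on the right come from x^i, from S with
  -- S' = x - 1, and from x^(i+1).
  square-one : ∀ i j k → (+ 2 + + i) * G (suc i) j k
    ≡ + 2 * (+ i * viaOne i (suc j) k) + + 2 * (G (suc i) j k - G i j k) + + 2 * ((+ 1 + + i) * G i j k)
  square-one zero j k = lem (viaOne 0 (suc j) k) (G 1 j k) (G 0 j k)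
    where
    lem : ∀ a x y → (+ 2 + + 0) * x ≡ + 2 * (+ 0 * a) + + 2 * (x - y) + + 2 * ((+ 1 + + 0) * y)
    lem = solve-∀
  square-one (suc i) j k rewrite viaOne-suc i (suc j) k | G-square i j k = lem (+ i) (G i (suc j) k) (G (suc i) j k)
    where
    lem : ∀ i a b → (+ 2 + (+ 1 + i)) * (+ 2 * a + + 2 * b)
      ≡ + 2 * ((+ 1 + i) * a) + + 2 * ((+ 2 * a + + 2 * b) - b) + + 2 * ((+ 1 + (+ 1 + i)) * b)
    lem = solve-∀

  square-two : ∀ i j k → + j * viaTwo (2 +ℕ i) j k
    ≡ + 2 * (+ j * (G (suc i) j k - G i j k)) + + 2 * (+ j * viaTwo (suc i) j k)
  square-two i zero k = lem (viaTwo (2 +ℕ i) 0 k) (G (suc i) 0 k - G i 0 k) (viaTwo (suc i) 0 k)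
    where
    lem : ∀ a b c → + 0 * a ≡ + 2 * (+ 0 * b) + + 2 * (+ 0 * c)
    lem = solve-∀
  square-two i (suc j) k
    rewrite viaTwo-suc (2 +ℕ i) j k | viaTwo-suc (suc i) j k | G-square (suc i) j k | G-square i j k
    = lem (+ 1 + + j) (G (suc i) (suc j) k) (G i (suc j) k) (G (suc i) j k)
    where
    lem : ∀ j a b c → j * ((+ 2 * a + + 2 * (+ 2 * b + + 2 * c)) - (+ 2 * b + + 2 * c))
      ≡ + 2 * (j * (a - b)) + + 2 * (j * ((+ 2 * b + + 2 * c) - c))
    lem = solve-∀

  -- The factor R' = S - x + 1 has three terms, and each uses the relation at the smaller `k`.
  square-fresh : ∀ i j k → viaFresh (2 +ℕ i) j k ≡ + 2 * viaFresh i (suc j) k + + 2 * viaFresh (suc i) j k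
  square-fresh i j zero rewrite viaFresh-zero (2 +ℕ i) j | viaFresh-zero (suc i) j | viaFresh-zero i (suc j) = refl
  square-fresh i j (suc k)
    rewrite viaFresh-suc (2 +ℕ i) j k | viaFresh-suc (suc i) j k | viaFresh-suc i (suc j) k
          | G-square i (suc j) k | G-square (suc i) j k | G-square i j k
    = lem (G i (suc (suc j)) k) (G (suc i) (suc j) k) (G i (suc j) k) (G (suc i) j k)
    where
    lem : ∀ a b c d →
      (+ 2 * a + + 2 * b) - ((+ 2 * b + + 2 * (+ 2 * c + + 2 * d)) - (+ 2 * c + + 2 * d))
      ≡ + 2 * (a - (b - c)) + + 2 * (b - ((+ 2 * c + + 2 * d) - d))
    lem = solve-∀

G-square i j k
  rewrite G-suc₁ (suc i) j k | square-one i j k | square-two i j k | square-fresh i j k | G-suc₂ i j k | G-suc₁ i j k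
  = lem (+ i * viaOne i (suc j) k) (+ j) _ _ _ _ _
  where
  lem : ∀ a j d g b f f′ →
    (+ 2 * a + + 2 * d + + 2 * g) + (+ 2 * (j * d) + + 2 * b) + (+ 2 * f + + 2 * f′)
    ≡ + 2 * (a + (+ 1 + j) * d + f) + + 2 * (g + b + f′)
  lem = solve-∀

-- The factor `1 + k` comes from the normalisation: R times R^k / k! is (k+1) R^(k+1) / (k+1)!. The
-- induction is organised as for `G-square`.
G-mixed : ∀ i j k → G (suc i) (suc j) k ≡ + 3 * (+ 1 + + k) * G i j (suc k) + + 4 * G i (suc j) k + G (suc i) j k

private
  mixed-one : ∀ i j k → + i * G i (suc j) k
    ≡ + 3 * (+ 1 + + k) * (+ i * viaOne i j (suc k)) + + 4 * (+ i * viaOne i (suc j) k) + + i * G i j k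
  mixed-one zero j k = lem (+ k) (G 0 (suc j) k) (viaOne 0 j (suc k)) (viaOne 0 (suc j) k) (G 0 j k)
    where
    lem : ∀ k a b c d → + 0 * a ≡ + 3 * (+ 1 + k) * (+ 0 * b) + + 4 * (+ 0 * c) + + 0 * d
    lem = solve-∀
  mixed-one (suc i) j k rewrite viaOne-suc i j (suc k) | viaOne-suc i (suc j) k | G-mixed i j k
    = lem (+ k) (+ 1 + + i) (G i j (suc k)) (G i (suc j) k) (G (suc i) j k)
    where
    lem : ∀ k i b c d → i * (+ 3 * (+ 1 + k) * b + + 4 * c + d)
      ≡ + 3 * (+ 1 + k) * (i * b) + + 4 * (i * c) + i * d
    lem = solve-∀

  mixed-two : ∀ i j k → + j * (G (2 +ℕ i) j k - G (suc i) j k)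
    ≡ + 3 * (+ 1 + + k) * (+ j * viaTwo i j (suc k)) + + 4 * (+ j * (G (suc i) j k - G i j k)) + + j * viaTwo (suc i) j k
  mixed-two i zero k = lem (+ k) (G (2 +ℕ i) 0 k - G (suc i) 0 k) (viaTwo i 0 (suc k)) (G (suc i) 0 k - G i 0 k) (viaTwo (suc i) 0 k)
    where
    lem : ∀ k a b c d → + 0 * a ≡ + 3 * (+ 1 + k) * (+ 0 * b) + + 4 * (+ 0 * c) + + 0 * d
    lem = solve-∀
  mixed-two i (suc j) k
    rewrite viaTwo-suc i j (suc k) | viaTwo-suc (suc i) j k | G-mixed (suc i) j k | G-mixed i j k
    = lem (+ k) (+ 1 + + j) (G (suc i) j (suc k)) (G i j (suc k)) (G i (suc j) k) (G (suc i) j k) (G (2 +ℕ i) j k)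
    where
    lem : ∀ k j a b c d e →
      j * ((+ 3 * (+ 1 + k) * a + + 4 * (+ 3 * (+ 1 + k) * b + + 4 * c + d) + e) - (+ 3 * (+ 1 + k) * b + + 4 * c + d))
      ≡ + 3 * (+ 1 + k) * (j * (a - b)) + + 4 * (j * ((+ 3 * (+ 1 + k) * b + + 4 * c + d) - c)) + j * (e - d)
    lem = solve-∀

  -- Here the derivative falls on R^k / k! alone, hence `k` and not `1 + k`: the other R is the one
  -- in xS = 3R + 4S + x, whose derivative enters in `G-mixed`.
  mixed-fresh : ∀ i j k → viaFresh (suc i) (suc j) k
    ≡ + 3 * + k * (G i (suc j) k - (G (suc i) j k - G i j k)) + + 4 * viaFresh i (suc j) k + viaFresh (suc i) j k
  mixed-fresh i j zero
    rewrite viaFresh-zero (suc i) (suc j) | viaFresh-zero (suc i) j | viaFresh-zero i (suc j)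
    = lem (G i (suc j) 0 - (G (suc i) j 0 - G i j 0))
    where
    lem : ∀ a → + 0 ≡ + 3 * + 0 * a + + 4 * + 0 + + 0
    lem = solve-∀
  mixed-fresh i j (suc k)
    rewrite viaFresh-suc (suc i) (suc j) k | viaFresh-suc (suc i) j k | viaFresh-suc i (suc j) k
          | G-mixed i (suc j) k | G-mixed (suc i) j k | G-mixed i j k
    = lem (+ k) (G i (suc j) (suc k)) (G i (2 +ℕ j) k) (G i j (suc k)) (G i (suc j) k) (G (suc i) j k)
          (G (suc i) j (suc k)) (G (2 +ℕ i) j k)
    where
    lem : ∀ k a b c d e f g →
      (+ 3 * (+ 1 + k) * a + + 4 * b + (+ 3 * (+ 1 + k) * c + + 4 * d + e))
        - ((+ 3 * (+ 1 + k) * f + + 4 * (+ 3 * (+ 1 + k) * c + + 4 * d + e) + g) - (+ 3 * (+ 1 + k) * c + + 4 * d + e))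
      ≡ + 3 * (+ 1 + k) * (a - (f - c)) + + 4 * (b - ((+ 3 * (+ 1 + k) * c + + 4 * d + e) - d))
        + ((+ 3 * (+ 1 + k) * c + + 4 * d + e) - (g - e))
    lem = solve-∀

G-mixed i j k = begin
  G (suc i) (suc j) k
    ≡⟨ trans (G-suc₁ i (suc j) k) (cong (λ t → (+ 1 + + i) * G i (suc j) k + (+ 1 + + j) * t + viaFresh (suc i) (suc j) k) (viaTwo-suc (suc i) j k)) ⟩
  (+ 1 + + i) * x + (+ 1 + + j) * (G (2 +ℕ i) j k - y) + viaFresh (suc i) (suc j) k
    -- One copy of each of the first two terms is set aside. Together they represent (xS)' = S + x²
    -- - x, where x is the integration variable.
    ≡⟨ split (+ i) (+ j) x (G (2 +ℕ i) j k) y _ ⟩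
  + i * x + + j * (G (2 +ℕ i) j k - y) + viaFresh (suc i) (suc j) k + (x + (G (2 +ℕ i) j k - y))
    ≡⟨ cong₂ _+_ (cong₂ _+_ (cong₂ _+_ (mixed-one i j k) (mixed-two i j k)) (mixed-fresh i j k))
         (cong (λ t → x + (t - y)) (G-square i j k)) ⟩
  (+ 3 * (+ 1 + + k) * (+ i * viaOne i j (suc k)) + + 4 * (+ i * viaOne i (suc j) k) + + i * z)
    + (+ 3 * (+ 1 + + k) * (+ j * viaTwo i j (suc k)) + + 4 * (+ j * (y - z)) + + j * viaTwo (suc i) j k)
    + (+ 3 * + k * (x - (y - z)) + + 4 * viaFresh i (suc j) k + viaFresh (suc i) j k)
    + (x + ((+ 2 * x + + 2 * y) - y))
    -- After x² = 2S + 2x, the part set aside is 3S + x = 3R' + 4S' + 1, the derivative of 3R + 4S +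
    -- x.
    ≡⟨ regroup (+ k) (+ i) (+ j) x y z (+ i * viaOne i j (suc k)) (+ i * viaOne i (suc j) k)
         (+ j * viaTwo i j (suc k)) (+ j * viaTwo (suc i) j k) (viaFresh i (suc j) k) (viaFresh (suc i) j k) ⟩
  + 3 * (+ 1 + + k) * (+ i * viaOne i j (suc k) + + j * viaTwo i j (suc k) + (x - (y - z)))
    + + 4 * (+ i * viaOne i (suc j) k + (+ 1 + + j) * (y - z) + viaFresh i (suc j) k)
    + ((+ 1 + + i) * z + + j * viaTwo (suc i) j k + viaFresh (suc i) j k)
    ≡⟨ cong₂ _+_ (cong₂ _+_ (cong (+ 3 * (+ 1 + + k) *_) (sym (G-suc₃ i j k))) (cong (+ 4 *_) (sym (G-suc₂ i j k))))
         (sym (G-suc₁ i j k)) ⟩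
  + 3 * (+ 1 + + k) * G i j (suc k) + + 4 * G i (suc j) k + G (suc i) j k ∎
  where
  open ≡-Reasoning
  x y z : ℤ
  x = G i (suc j) k
  y = G (suc i) j k
  z = G i j k
  split : ∀ i j x w y f → (+ 1 + i) * x + (+ 1 + j) * (w - y) + f ≡ i * x + j * (w - y) + f + (x + (w - y))
  split = solve-∀
  regroup : ∀ k i j x y z a a′ b b′ f f′ →
    (+ 3 * (+ 1 + k) * a + + 4 * a′ + i * z) + (+ 3 * (+ 1 + k) * b + + 4 * (j * (y - z)) + b′)
      + (+ 3 * k * (x - (y - z)) + + 4 * f + f′) + (x + ((+ 2 * x + + 2 * y) - y))
    ≡ + 3 * (+ 1 + k) * (a + b + (x - (y - z))) + + 4 * (a′ + (+ 1 + j) * (y - z) + f) + ((+ 1 + i) * z + b′ + f′)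
  regroup = solve-∀

-- The recurrences for `P` and `Q`.

-- In `Q n` the previous letter has one copy left, so the `G 0 0 n` completions that repeat it at
-- once are removed.
P Q : ℕ → ℤ
P n = G 0 0 n
Q n = G 1 0 n - G 0 0 n

P-suc : ∀ n → P (suc n) ≡ G 0 1 n - Q n
P-suc n rewrite G-suc₃ 0 0 n = lem (viaOne 0 0 (suc n)) (viaTwo 0 0 (suc n)) (G 0 1 n) (Q n)
  where
  lem : ∀ a b c d → + 0 * a + + 0 * b + (c - d) ≡ c - d
  lem = solve-∀

coeff-+ : ∀ m c → + (3 *ℕ suc m +ℕ c) ≡ + 3 * (+ 1 + + m) + + c
coeff-+ m c = trans (pos-+ (3 *ℕ suc m) c) (cong (_+ + c) (pos-* 3 (suc m)))

private
  G-01 : ∀ n → G 0 1 n ≡ P (suc n) + Q n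
  G-01 n rewrite P-suc n = lem (G 0 1 n) (Q n)
    where
    lem : ∀ a b → a ≡ (a - b) + b
    lem = solve-∀

  G-10 : ∀ n → G 1 0 n ≡ Q n + P n
  G-10 n = lem (G 1 0 n) (P n)
    where
    lem : ∀ a b → a ≡ (a - b) + b
    lem = solve-∀

-- By the two relations the fresh term is xS - x² + x = 3R + 2S under the integral. R yields the
-- coefficient `3 *ℕ suc n`, and S stands for `P (suc n) + Q n` by `P-suc`.
Q-rec : ∀ n → Q (suc n) ≡ + (3 *ℕ suc n +ℕ 2) * P (suc n) + + 2 * Q n
Q-rec n = begin
  G 1 0 (suc n) - P (suc n)
    ≡⟨ cong (_- P (suc n)) (trans (G-suc₁ 0 0 (suc n)) (cong (λ t → + 1 * P (suc n) + + 0 * viaTwo 1 0 (suc n) + t) (viaFresh-suc 1 0 n))) ⟩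
  (+ 1 * P (suc n) + + 0 * viaTwo 1 0 (suc n) + (G 1 1 n - (G 2 0 n - G 1 0 n))) - P (suc n)
    ≡⟨ cong₂ (λ s t → (+ 1 * P (suc n) + + 0 * viaTwo 1 0 (suc n) + (s - (t - G 1 0 n))) - P (suc n)) (G-mixed 0 0 n) (G-square 0 0 n) ⟩
  _ ≡⟨ cong (λ s → (+ 1 * P (suc n) + + 0 * viaTwo 1 0 (suc n) + ((+ 3 * (+ 1 + + n) * P (suc n) + + 4 * s + G 1 0 n) - ((+ 2 * s + + 2 * G 1 0 n) - G 1 0 n))) - P (suc n)) (G-01 n) ⟩
  _ ≡⟨ lem (+ n) (P (suc n)) (Q n) (G 1 0 n) (viaTwo 1 0 (suc n)) ⟩
  (+ 3 * (+ 1 + + n) + + 2) * P (suc n) + + 2 * Q n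
    ≡⟨ cong (λ t → t * P (suc n) + + 2 * Q n) (sym (coeff-+ n 2)) ⟩
  + (3 *ℕ suc n +ℕ 2) * P (suc n) + + 2 * Q n ∎
  where
  open ≡-Reasoning
  lem : ∀ n p q g b →
    (+ 1 * p + + 0 * b + ((+ 3 * (+ 1 + n) * p + + 4 * (p + q) + g) - ((+ 2 * (p + q) + + 2 * g) - g))) - p
    ≡ (+ 3 * (+ 1 + n) + + 2) * p + + 2 * q
  lem = solve-∀

private
  -- Each of the two relations expands `G 2 1 n`; comparing the results isolates the S² term.
  twice-G-02 : ∀ n → + 2 * G 0 2 n ≡ + 3 * (+ 1 + + n) * G 1 0 (suc n) + + 2 * G 1 1 n + G 2 0 n
  twice-G-02 n = trans (lem₁ _ _ _ (G-square 0 1 n)) (trans (cong (λ t → t - + 2 * G 1 1 n) (G-mixed 1 0 n)) (lem₂ (+ 3 * (+ 1 + + n) * G 1 0 (suc n)) (G 1 1 n) (G 2 0 n)))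
    where
    lem₁′ : ∀ y z → + 2 * y ≡ (+ 2 * y + + 2 * z) - + 2 * z
    lem₁′ = solve-∀
    lem₁ : ∀ x y z → x ≡ + 2 * y + + 2 * z → + 2 * y ≡ x - + 2 * z
    lem₁ x y z refl = lem₁′ y z
    lem₂ : ∀ a b c → (a + + 4 * b + c) - + 2 * b ≡ a + + 2 * b + c
    lem₂ = solve-∀

-- Unfolding twice gives `G 0 2 n - G 1 1 n + G 0 1 n` for `P (suc (suc n))`. Doubling makes
-- `twice-G-02` applicable, and then `G 1 1 n` cancels.
P-rec : ∀ n → + 2 * P (suc (suc n))
  ≡ + (3 *ℕ suc n +ℕ 3) * Q (suc n) - + 2 * + (3 *ℕ suc n +ℕ 1) * P (suc n) + + 2 * P n
P-rec n
  rewrite P-suc (suc n) | G-suc₂ 0 0 (suc n) | viaFresh-suc 0 1 n | coeff-+ n 3 | coeff-+ n 1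
  = begin
  + 2 * ((+ 0 * viaOne 0 1 (suc n) + + 1 * Q (suc n) + (G 0 2 n - (G 1 1 n - G 0 1 n))) - Q (suc n))
    ≡⟨ lem₁ (viaOne 0 1 (suc n)) (Q (suc n)) (G 0 2 n) (G 1 1 n) (G 0 1 n) ⟩
  + 2 * G 0 2 n - + 2 * (G 1 1 n - G 0 1 n)
    ≡⟨ cong (_- + 2 * (G 1 1 n - G 0 1 n)) (twice-G-02 n) ⟩
  (+ 3 * (+ 1 + + n) * G 1 0 (suc n) + + 2 * G 1 1 n + G 2 0 n) - + 2 * (G 1 1 n - G 0 1 n)
    ≡⟨ cong (λ t → (+ 3 * (+ 1 + + n) * G 1 0 (suc n) + + 2 * G 1 1 n + t) - + 2 * (G 1 1 n - G 0 1 n)) (G-square 0 0 n) ⟩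
  (+ 3 * (+ 1 + + n) * G 1 0 (suc n) + + 2 * G 1 1 n + (+ 2 * G 0 1 n + + 2 * G 1 0 n)) - + 2 * (G 1 1 n - G 0 1 n)
    ≡⟨ lem₂ (+ n) (G 1 0 (suc n)) (G 1 1 n) (G 0 1 n) (G 1 0 n) ⟩
  + 3 * (+ 1 + + n) * G 1 0 (suc n) + + 4 * G 0 1 n + + 2 * G 1 0 n
    ≡⟨ cong₂ _+_ (cong₂ _+_ (cong (+ 3 * (+ 1 + + n) *_) (G-10 (suc n))) (cong (+ 4 *_) (G-01 n))) (cong (+ 2 *_) (G-10 n)) ⟩
  + 3 * (+ 1 + + n) * (Q (suc n) + P (suc n)) + + 4 * (P (suc n) + Q n) + + 2 * (Q n + P n)
    ≡⟨ lem₃ (+ n) (Q (suc n)) (P (suc n)) (Q n) (P n) ⟩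
  + 3 * (+ 1 + + n) * (Q (suc n) + P (suc n)) + + 4 * P (suc n) + + 3 * (+ 2 * Q n) + + 2 * P n
    -- The goal has no `Q n`, so its six copies are traded in pairs for `Q (suc n)` and `P (suc n)`
    -- by `Q-rec`.
    ≡⟨ cong (λ t → + 3 * (+ 1 + + n) * (Q (suc n) + P (suc n)) + + 4 * P (suc n) + + 3 * t + + 2 * P n) twice-Q ⟩
  + 3 * (+ 1 + + n) * (Q (suc n) + P (suc n)) + + 4 * P (suc n)
    + + 3 * (Q (suc n) - (+ 3 * (+ 1 + + n) + + 2) * P (suc n)) + + 2 * P n
    ≡⟨ lem₄ (+ n) (Q (suc n)) (P (suc n)) (P n) ⟩
  (+ 3 * (+ 1 + + n) + + 3) * Q (suc n) - + 2 * (+ 3 * (+ 1 + + n) + + 1) * P (suc n) + + 2 * P n ∎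
  where
  open ≡-Reasoning
  lem₁ : ∀ a q x y z → + 2 * ((+ 0 * a + + 1 * q + (x - (y - z))) - q) ≡ + 2 * x - + 2 * (y - z)
  lem₁ = solve-∀
  lem₂ : ∀ n a b c d → (+ 3 * (+ 1 + n) * a + + 2 * b + (+ 2 * c + + 2 * d)) - + 2 * (b - c)
    ≡ + 3 * (+ 1 + n) * a + + 4 * c + + 2 * d
  lem₂ = solve-∀
  lem₃ : ∀ n q p q′ p′ → + 3 * (+ 1 + n) * (q + p) + + 4 * (p + q′) + + 2 * (q′ + p′)
    ≡ + 3 * (+ 1 + n) * (q + p) + + 4 * p + + 3 * (+ 2 * q′) + + 2 * p′
  lem₃ = solve-∀
  lem₄ : ∀ n q p p′ → + 3 * (+ 1 + n) * (q + p) + + 4 * p + + 3 * (q - (+ 3 * (+ 1 + n) + + 2) * p) + + 2 * p′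
    ≡ (+ 3 * (+ 1 + n) + + 3) * q - + 2 * (+ 3 * (+ 1 + n) + + 1) * p + + 2 * p′
  lem₄ = solve-∀
  lem₅ : ∀ a b → b ≡ (a + b) - a
  lem₅ = solve-∀
  twice-Q : + 2 * Q n ≡ Q (suc n) - (+ 3 * (+ 1 + + n) + + 2) * P (suc n)
  twice-Q = trans (lem₅ ((+ 3 * (+ 1 + + n) + + 2) * P (suc n)) (+ 2 * Q n))
    (cong (_- (+ 3 * (+ 1 + + n) + + 2) * P (suc n))
      (sym (trans (Q-rec n) (cong (λ t → t * P (suc n) + + 2 * Q n) (coeff-+ n 2)))))

-- The recurrence for `p` reaches back two steps, so the induction carries two consecutive values of
-- `p`. The value of `q` at `suc n` is found first because the next value of `p` depends on it.
recurrence-unique : (p q : ℕ → ℤ) →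
  p 0 ≡ + 1 → p 1 ≡ + 0 → q 0 ≡ + 0 →
  (∀ n → + 2 * p (suc (suc n))
    ≡ + (3 *ℕ suc n +ℕ 3) * q (suc n) - + 2 * + (3 *ℕ suc n +ℕ 1) * p (suc n) + + 2 * p n) →
  (∀ n → q (suc n) ≡ + (3 *ℕ suc n +ℕ 2) * p (suc n) + + 2 * q n) →
  ∀ n → p n ≡ P n × p (suc n) ≡ P (suc n) × q n ≡ Q n
recurrence-unique p q p₀ p₁ q₀ p-rec q-rec zero =
  trans p₀ (sym G-000) , trans p₁ (sym G-001) , trans q₀ (sym (cong₂ _-_ G-100 G-000))
recurrence-unique p q p₀ p₁ q₀ p-rec q-rec (suc n)
  with pₙ , pₙ₊₁ , qₙ ← recurrence-unique p q p₀ p₁ q₀ p-rec q-rec n = pₙ₊₁ , pₙ₊₂ , qₙ₊₁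
  where
  qₙ₊₁ : q (suc n) ≡ Q (suc n)
  qₙ₊₁ = trans (q-rec n) (trans (cong₂ (λ s t → + (3 *ℕ suc n +ℕ 2) * s + + 2 * t) pₙ₊₁ qₙ) (sym (Q-rec n)))
  pₙ₊₂ : p (suc (suc n)) ≡ P (suc (suc n))
  -- The recurrence determines only twice the value, and 2 is cancelled in ℤ.
  pₙ₊₂ = *-cancelˡ-≡ (+ 2) _ _ (trans (p-rec n) (trans
    (cong₂ _+_ (cong₂ (λ s t → + (3 *ℕ suc n +ℕ 3) * s - + 2 * + (3 *ℕ suc n +ℕ 1) * t) qₙ₊₁ pₙ₊₁) (cong (+ 2 *_) pₙ))
    (sym (P-rec n))))

-- Finite enumerations of words.

-- The size is recorded as an integer, so that identities with subtraction can be applied to it by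
-- `subst`.
record Enumeration (P : List ℕ → Set) (z : ℤ) : Set where
  field
    words    : List (List ℕ)
    unique   : Unique words
    sound    : ∀ {w} → w ∈ words → P w
    complete : ∀ {w} → P w → w ∈ words
    size     : z ≡ + length words
open Enumeration

enum-⇔ : ∀ {P Q z} → (∀ {w} → P w ⇔ Q w) → Enumeration P z → Enumeration Q z
enum-⇔ P⇔Q e = record
  { words = words e ; unique = unique e ; size = size e
  ; sound = to P⇔Q ∘ sound e ; complete = complete e ∘ from P⇔Q }

enum-∅ : ∀ {P} → (∀ {w} → ¬ P w) → Enumeration P (+ 0)
enum-∅ ¬P = record
  { words = [] ; unique = [] ; sound = λ () ; complete = λ p → ⊥-elim (¬P p) ; size = refl }

enum-[] : ∀ {P} → P [] → (∀ {w} → P w → w ≡ []) → Enumeration P (+ 1)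
enum-[] p P⇒[] = record
  { words = [] ∷ [] ; unique = [] ∷ [] ; size = refl
  ; sound = λ { (here refl) → p } ; complete = λ q → here (P⇒[] q) }

data Cons (x : ℕ) (P : List ℕ → Set) : List ℕ → Set where
  cons : ∀ {w} → P w → Cons x P (x ∷ w)

enum-cons : ∀ {P z} x → Enumeration P z → Enumeration (Cons x P) z
enum-cons {P} x e = record
  { words = map (x ∷_) (words e)
  ; unique = map⁺ (proj₂ ∘ ∷-injective) (unique e)
  ; sound = λ w∈ → sound′ (∈-map⁻ (x ∷_) w∈)
  ; complete = λ { (cons p) → ∈-map⁺ (x ∷_) (complete e p) }
  ; size = trans (size e) (cong +_ (sym (length-map (x ∷_) (words e)))) }
  where
  sound′ : ∀ {w} → ∃ (λ v → v ∈ words e × w ≡ x ∷ v) → Cons x P w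
  sound′ (v , v∈ , refl) = cons (sound e v∈)

enum-⊎ : ∀ {P Q y z} → (∀ {w} → P w → Q w → ⊥) →
  Enumeration P y → Enumeration Q z → Enumeration (λ w → P w ⊎ Q w) (y + z)
enum-⊎ {P} {Q} disjoint d e = record
  { words = words d ++ words e
  ; unique = ++⁺ (unique d) (unique e) (λ { (w∈d , w∈e) → disjoint (sound d w∈d) (sound e w∈e) })
  ; sound = λ w∈ → sound′ (∈-++⁻ (words d) w∈)
  ; complete = λ { (inj₁ p) → ∈-++⁺ˡ (complete d p) ; (inj₂ q) → ∈-++⁺ʳ (words d) (complete e q) }
  ; size = trans (cong₂ _+_ (size d) (size e))
      (trans (sym (pos-+ (length (words d)) _)) (cong +_ (sym (length-++ (words d))))) }
  where
  sound′ : ∀ {w} → w ∈ words d ⊎ w ∈ words e → P w ⊎ Q w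
  sound′ (inj₁ w∈) = inj₁ (sound d w∈)
  sound′ (inj₂ w∈) = inj₂ (sound e w∈)

sumBelow : ℕ → (ℕ → ℤ) → ℤ
sumBelow zero    f = + 0
sumBelow (suc m) f = f m + sumBelow m f

data HeadBelow (m : ℕ) (P : ℕ → List ℕ → Set) : List ℕ → Set where
  head : ∀ {x w} → x < m → P x w → HeadBelow m P (x ∷ w)

enum-head : ∀ {P : ℕ → List ℕ → Set} {z} m → (∀ x → x < m → Enumeration (P x) (z x)) →
  Enumeration (HeadBelow m P) (sumBelow m z)
enum-head zero e = enum-∅ λ { (head () _) }
enum-head {P} (suc m) e = enum-⇔ (mk⇔ fwd bwd)
  (enum-⊎ (λ { (cons _) (head m<m _) → <-irrefl refl m<m })
    (enum-cons m (e m ≤-refl)) (enum-head m (λ x x<m → e x (m<n⇒m<1+n x<m))))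
  where
  fwd : ∀ {w} → Cons m (P m) w ⊎ HeadBelow m P w → HeadBelow (suc m) P w
  fwd (inj₁ (cons p))     = head ≤-refl p
  fwd (inj₂ (head x<m p)) = head (m<n⇒m<1+n x<m) p
  bwd : ∀ {w} → HeadBelow (suc m) P w → Cons m (P m) w ⊎ HeadBelow m P w
  bwd (head x<1+m p) with m<1+n⇒m<n∨m≡n x<1+m
  ... | inj₁ x<m  = inj₂ (head x<m p)
  ... | inj₂ refl = inj₁ (cons p)

lookup-injective : ∀ {A : Set} {xs : List A} → Unique xs → ∀ i j → lookup xs i ≡ lookup xs j → i ≡ j
lookup-injective (x∉ ∷ u) zero    zero    eq = refl
lookup-injective (x∉ ∷ u) zero    (suc j) eq = contradiction eq (All.lookup x∉ (∈-lookup j))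
lookup-injective (x∉ ∷ u) (suc i) zero    eq = contradiction (sym eq) (All.lookup x∉ (∈-lookup i))
lookup-injective (x∉ ∷ u) (suc i) (suc j) eq = cong suc (lookup-injective u i j eq)

-- Proofs of `T` are unique, so a pair is determined by its word; since the list has no duplicates,
-- a word also determines its position.
enum-↔ : ∀ {b : List ℕ → Bool} {z} → Enumeration (T ∘ b) z → ∃ λ k → (Fin k ↔ Σ (List ℕ) (T ∘ b)) × z ≡ + k
enum-↔ {b} e = length (words e) , mk↔ₛ′ word position word-position position-word , size e
  where
  word : Fin (length (words e)) → Σ (List ℕ) (T ∘ b)
  word i = lookup (words e) i , sound e (∈-lookup i)
  position : Σ (List ℕ) (T ∘ b) → Fin (length (words e))
  position (w , p) = Any.index (complete e p)
  Σ-≡ : ∀ {v w} {p : T (b v)} {q : T (b w)} → v ≡ w → (v , p) ≡ (w , q)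
  Σ-≡ refl = cong (_ ,_) (T-irrelevant _ _)
  word-position : ∀ wp → word (position wp) ≡ wp
  word-position (w , p) = Σ-≡ (sym (lookup-index (complete e p)))
  position-word : ∀ i → position (word i) ≡ i
  position-word i = lookup-injective (unique e) _ _ (sym (lookup-index (complete e (sound e (∈-lookup i)))))

-- Point updates, and sums and counts over the used letters.

upd : ∀ {A : Set} → (ℕ → A) → ℕ → A → ℕ → A
upd f x v y = if y ≡ᵇ x then v else f y

≡ᵇ-refl : ∀ x → (x ≡ᵇ x) ≡ true
≡ᵇ-refl zero    = refl
≡ᵇ-refl (suc x) = ≡ᵇ-refl x

≢⇒≡ᵇ : ∀ {x y} → x ≢ y → (x ≡ᵇ y) ≡ false
≢⇒≡ᵇ {x} {y} x≢y with x ≡ᵇ y in eq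
... | false = refl
... | true  = contradiction (≡ᵇ⇒≡ x y (subst T (sym eq) _)) x≢y

upd-same : ∀ {A : Set} (f : ℕ → A) x {v} → upd f x v x ≡ v
upd-same f x rewrite ≡ᵇ-refl x = refl

upd-other : ∀ {A : Set} (f : ℕ → A) {x y v} → y ≢ x → upd f x v y ≡ f y
upd-other f y≢x rewrite ≢⇒≡ᵇ y≢x = refl

sumBelow-upd-≥ : ∀ m f {l v} → m ≤ l → sumBelow m (upd f l v) ≡ sumBelow m f
sumBelow-upd-≥ zero    f m≤l = refl
sumBelow-upd-≥ (suc m) f m<l = cong₂ _+_ (upd-other f (<⇒≢ m<l)) (sumBelow-upd-≥ m f (<⇒≤ m<l))

-- Zeroing the summand of the forbidden previous letter produces the single correction term.
sumBelow-remove : ∀ m f {l} → l < m → sumBelow m (upd f l (+ 0)) ≡ sumBelow m f - f l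
sumBelow-remove (suc m) f {l} l<1+m with m<1+n⇒m<n∨m≡n l<1+m
... | inj₁ l<m  = trans (cong₂ _+_ (upd-other f (<⇒≢ l<m ∘ sym)) (sumBelow-remove m f l<m)) (lem (f m) _ (f l))
  where
  lem : ∀ a b c → a + (b - c) ≡ (a + b) - c
  lem = solve-∀
... | inj₂ refl = trans (cong₂ _+_ (upd-same f l) (sumBelow-upd-≥ m f ≤-refl)) (lem (f m) _)
  where
  lem : ∀ a b → + 0 + b ≡ (a + b) - a
  lem = solve-∀

indicator : ℕ → ℕ → ℕ
indicator r s = if s ≡ᵇ r then 1 else 0

count : ℕ → ℕ → (ℕ → ℕ) → ℕ
count r zero    f = 0
count r (suc m) f = indicator r (f m) +ℕ count r m f

count-upd-≥ : ∀ r m f {x v} → m ≤ x → count r m (upd f x v) ≡ count r m f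
count-upd-≥ r zero    f m≤x = refl
count-upd-≥ r (suc m) f m<x = cong₂ _+ℕ_ (cong (indicator r) (upd-other f (<⇒≢ m<x))) (count-upd-≥ r m f (<⇒≤ m<x))

-- Written as a balance of old and new indicators, which avoids subtraction in ℕ.
count-upd : ∀ r m f {x u} v → x < m → f x ≡ u → indicator r u +ℕ count r m (upd f x v) ≡ indicator r v +ℕ count r m f
count-upd r (suc m) f {x} v x<1+m refl with m<1+n⇒m<n∨m≡n x<1+m
... | inj₁ x<m rewrite upd-other f {x} {m} {v} (<⇒≢ x<m ∘ sym) =
  trans (x∙yz≈y∙xz (indicator r (f x)) (indicator r (f m)) _)
    (trans (cong (indicator r (f m) +ℕ_) (count-upd r m f v x<m refl)) (x∙yz≈y∙xz (indicator r (f m)) (indicator r v) _))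
... | inj₂ refl rewrite upd-same f m {v} | count-upd-≥ r m f {m} {v} ≤-refl =
  x∙yz≈y∙xz (indicator r (f x)) (indicator r v) _

count-zeros : ∀ r m {f} → (∀ x → f x ≡ 0) → count (suc r) m f ≡ 0
count-zeros r zero    f≡0 = refl
count-zeros r (suc m) f≡0 rewrite f≡0 m = count-zeros r m f≡0

count≡0⇒≢ : ∀ r m f → count r m f ≡ 0 → ∀ {x} → x < m → f x ≢ r
count≡0⇒≢ r (suc m) f c≡0 x<1+m with m<1+n⇒m<n∨m≡n x<1+m
... | inj₁ x<m  = count≡0⇒≢ r m f (m+n≡0⇒n≡0 (indicator r (f m)) c≡0) x<m
... | inj₂ refl = λ fm≡r → 1≢0 (subst (λ b → (if b then 1 else 0) ≡ 0) (eq fm≡r) (m+n≡0⇒m≡0 _ c≡0))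
  where
  1≢0 : 1 ≢ 0
  1≢0 ()
  eq : f m ≡ r → (f m ≡ᵇ r) ≡ true
  eq refl = ≡ᵇ-refl (f m)

-- Letters with equally many copies left contribute equally, so the sum over letters collapses to
-- the two coefficients in the recursion for `G`.
sumBelow-count : ∀ m {f} (g : ℕ → ℤ) → g 0 ≡ + 0 → (∀ {x} → x < m → f x ≤ 2) →
  sumBelow m (g ∘ f) ≡ + count 1 m f * g 1 + + count 2 m f * g 2
sumBelow-count zero g g0 f≤2 = refl
sumBelow-count (suc m) {f} g g0 f≤2 with f m | f≤2 (n<1+n m) | sumBelow-count m {f} g g0 (f≤2 ∘ m<n⇒m<1+n)
... | 0 | _ | ih rewrite g0 | ih = lem (+ count 1 m f * g 1) (+ count 2 m f * g 2)
  where
  lem : ∀ a b → + 0 + (a + b) ≡ a + b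
  lem = solve-∀
... | 1 | _ | ih rewrite ih = lem (+ count 1 m f) (+ count 2 m f) (g 1) (g 2)
  where
  lem : ∀ a b c d → c + (a * c + b * d) ≡ (+ 1 + a) * c + b * d
  lem = solve-∀
... | 2 | _ | ih rewrite ih = lem (+ count 1 m f) (+ count 2 m f) (g 1) (g 2)
  where
  lem : ∀ a b c d → d + (a * c + b * d) ≡ a * c + (+ 1 + b) * d
  lem = solve-∀
... | suc (suc (suc _)) | s≤s (s≤s ()) | _

-- Run m k l rem w: the word w completes a prefix that has used the letters
-- below m and ended in l, where m, ..., m + k - 1 are unused and rem x copies
-- of each x are still to come.
data Run : (m k l : ℕ) (rem : ℕ → ℕ) → List ℕ → Set where
  done  : ∀ {m l rem} → (∀ x → rem x ≡ 0) → Run m 0 l rem []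
  old   : ∀ {m k l rem x r w} → x < m → x ≢ l → rem x ≡ suc r → Run m k x (upd rem x r) w → Run m k l rem (x ∷ w)
  fresh : ∀ {m k l rem r w} → rem m ≡ suc r → Run (suc m) k m (upd rem m r) w → Run m (suc k) l rem (m ∷ w)

-- States of a partly read word and the number of their runs.

record State (m k l : ℕ) (rem : ℕ → ℕ) (i j : ℕ) : Set where
  field
    last-used : l < m
    used      : ∀ {x} → x < m → rem x ≤ 2
    unused    : ∀ {x} → m ≤ x → x < m +ℕ k → rem x ≡ 3
    absent    : ∀ {x} → m +ℕ k ≤ x → rem x ≡ 0
    ones      : count 1 m rem ≡ i
    twos      : count 2 m rem ≡ j
open State

-- The change in `i` and `j` depends on how many copies `x` had, so the caller supplies the new
-- counts.
state-old : ∀ {m k l rem i j x r i′ j′} → State m k l rem i j → x < m → r ≤ 2 →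
  count 1 m (upd rem x r) ≡ i′ → count 2 m (upd rem x r) ≡ j′ → State m k x (upd rem x r) i′ j′
state-old {m} {k} {rem = rem} {x = x} {r} s x<m r≤2 ones′ twos′ = record
  { last-used = x<m ; used = used′ ; ones = ones′ ; twos = twos′
  ; unused = λ m≤y y< → trans (upd-other rem (<⇒≢ (<-≤-trans x<m m≤y) ∘ sym)) (unused s m≤y y<)
  ; absent = λ m+k≤y → trans (upd-other rem (<⇒≢ (<-≤-trans x<m (≤-trans (m≤m+n m k) m+k≤y)) ∘ sym)) (absent s m+k≤y) }
  where
  used′ : ∀ {y} → y < m → upd rem x r y ≤ 2
  used′ {y} y<m with y ≡ᵇ x
  ... | true  = r≤2
  ... | false = used s y<m

state-fresh : ∀ {m k l rem i j} → State m (suc k) l rem i j → State (suc m) k m (upd rem m 2) i (suc j)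
state-fresh {m} {k} {rem = rem} s = record
  { last-used = ≤-refl
  ; used = used′
  ; unused = λ {y} m<y y< → trans (upd-other rem (<⇒≢ m<y ∘ sym)) (unused s (<⇒≤ m<y) (subst (y <_) (sym (+-suc m k)) y<))
  ; absent = λ {y} m+k<y → trans (upd-other rem (<⇒≢ (≤-<-trans (m≤m+n m k) m+k<y) ∘ sym))
               (absent s (subst (_≤ y) (sym (+-suc m k)) m+k<y))
  -- Updating at `m` leaves the letters below `m` alone; the new letter, with two copies left, adds
  -- only to `twos`.
  ; ones = trans (cong₂ _+ℕ_ (cong (indicator 1) (upd-same rem m)) (count-upd-≥ 1 m rem ≤-refl)) (ones s)
  ; twos = trans (cong₂ _+ℕ_ (cong (indicator 2) (upd-same rem m)) (count-upd-≥ 2 m rem ≤-refl)) (cong suc (twos s)) }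
  where
  used′ : ∀ {y} → y < suc m → upd rem m 2 y ≤ 2
  used′ {y} y<1+m with m<1+n⇒m<n∨m≡n y<1+m
  ... | inj₁ y<m  = subst (_≤ 2) (sym (upd-other rem (<⇒≢ y<m))) (used s y<m)
  ... | inj₂ refl = subst (_≤ 2) (sym (upd-same rem m)) ≤-refl

-- The first argument is the number of copies the chosen letter has left. Used letters have at most
-- two, so in a `State` the default means that none is left.
via : ℕ → ℕ → ℕ → ℕ → ℤ
via 1 i j k = viaOne i j k
via 2 i j k = viaTwo i j k
via _ i j k = + 0

Done : (k : ℕ) (rem : ℕ → ℕ) → List ℕ → Set
Done k rem w = w ≡ [] × k ≡ 0 × (∀ x → rem x ≡ 0)

Old : (m k l : ℕ) (rem : ℕ → ℕ) → ℕ → List ℕ → Set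
Old m k l rem x w = x ≢ l × ∃ λ r → rem x ≡ suc r × Run m k x (upd rem x r) w

Fresh : (m k : ℕ) (rem : ℕ → ℕ) → List ℕ → Set
Fresh m k rem w = ∃ λ k′ → k ≡ suc k′ × ∃ λ r → rem m ≡ suc r × Run (suc m) k′ m (upd rem m r) w

-- If `i`, `j` and `k` vanish, no used letter has one or two copies left, so by the bound 2 nothing
-- is owed. Otherwise some letter is still to come.
enum-done : ∀ {m k l rem i j} → State m k l rem i j → Enumeration (Done k rem) (isZero i j k)
enum-done {m} {zero} {rem = rem} {zero} {zero} s = enum-[] (refl , refl , all-zero) proj₁
  where
  used-zero : ∀ {x} → x < m → rem x ≡ 0
  used-zero {x} x<m
    with rem x | used s x<m | count≡0⇒≢ 1 m rem (ones s) x<m | count≡0⇒≢ 2 m rem (twos s) x<m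
  ... | 0 | _ | _ | _ = refl
  ... | 1 | _ | r≢1 | _ = contradiction refl r≢1
  ... | 2 | _ | _ | r≢2 = contradiction refl r≢2
  ... | suc (suc (suc _)) | s≤s (s≤s ()) | _ | _
  all-zero : ∀ x → rem x ≡ 0
  all-zero x with x <? m
  ... | yes x<m = used-zero x<m
  ... | no  x≮m = absent s (subst (_≤ x) (sym (+-identityʳ m)) (≮⇒≥ x≮m))
enum-done {m} {zero} {i = suc i} s =
  enum-∅ λ (_ , _ , rem≡0) → contradiction (trans (sym (ones s)) (count-zeros 0 m rem≡0)) λ ()
enum-done {m} {zero} {i = zero} {suc j} s =
  enum-∅ λ (_ , _ , rem≡0) → contradiction (trans (sym (twos s)) (count-zeros 1 m rem≡0)) λ ()
enum-done {k = suc k} {i = i} {j} s rewrite isZero-suc₃ i j k = enum-∅ λ { (_ , () , _) }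

run-cases : ∀ {m k l rem w} → ((Done k rem w ⊎ HeadBelow m (Old m k l rem) w) ⊎ Cons m (Fresh m k rem) w) ⇔ Run m k l rem w
run-cases = mk⇔ fwd bwd
  where
  fwd : ∀ {m k l rem w} → (Done k rem w ⊎ HeadBelow m (Old m k l rem) w) ⊎ Cons m (Fresh m k rem) w → Run m k l rem w
  fwd (inj₁ (inj₁ (refl , refl , rem≡0)))              = done rem≡0
  fwd (inj₁ (inj₂ (head x<m (x≢l , r , rem-x , run)))) = old x<m x≢l rem-x run
  fwd (inj₂ (cons (k , refl , r , rem-m , run)))       = fresh rem-m run
  bwd : ∀ {m k l rem w} → Run m k l rem w → (Done k rem w ⊎ HeadBelow m (Old m k l rem) w) ⊎ Cons m (Fresh m k rem) w
  bwd (done rem≡0)             = inj₁ (inj₁ (refl , refl , rem≡0))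
  bwd (old x<m x≢l rem-x run)  = inj₁ (inj₂ (head x<m (x≢l , _ , rem-x , run)))
  bwd (fresh rem-m run)        = inj₂ (cons (_ , refl , _ , rem-m , run))

-- The combinatorial meaning of `G`: summing over all used letters would give `G i j k`, and leaving
-- out `l` subtracts its summand. The order `k`, `j`, `i` of the arguments is the lexicographic
-- order in which the recursion descends.
enum-run : ∀ k j i {m l rem} → State m k l rem i j →
  Enumeration (Run m k l rem) (G i j k - via (rem l) i j k)
enum-old : ∀ k j i {m l rem} → State m k l rem i j → ∀ r x → x < m → x ≢ l → rem x ≡ r →
  Enumeration (Old m k l rem x) (via r i j k)
enum-fresh : ∀ k j i {m l rem} → State m k l rem i j → Enumeration (Fresh m k rem) (viaFresh i j k)

enum-run k j i {m} {l} {rem} s = subst (Enumeration _) total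
  (enum-⇔ run-cases
    (enum-⊎ (λ { (inj₁ (() , _)) (cons _) ; (inj₂ (head m<m _)) (cons _) → <-irrefl refl m<m })
      (enum-⊎ (λ { (() , _) (head _ _) }) (enum-done s) (enum-head m enum-letter))
      (enum-cons m (enum-fresh k j i s))))
  where
  value : ℕ → ℤ
  value x = via (rem x) i j k
  -- The previous letter admits no word, which matches the summand zeroed by `upd`.
  enum-letter : ∀ x → x < m → Enumeration (Old m k l rem x) (upd value l (+ 0) x)
  enum-letter x x<m with x ≟ l
  ... | yes refl = subst (Enumeration _) (sym (upd-same value x)) (enum-∅ λ (x≢x , _) → x≢x refl)
  ... | no  x≢l  = subst (Enumeration _) (sym (upd-other value x≢l)) (enum-old k j i s (rem x) x x<m x≢l refl)
  lem : ∀ u a b c d → (u + ((a + b) - c)) + d ≡ (u + a + b + d) - c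
  lem = solve-∀
  total : (isZero i j k + sumBelow m (upd value l (+ 0))) + viaFresh i j k ≡ G i j k - via (rem l) i j k
  total = begin
    (isZero i j k + sumBelow m (upd value l (+ 0))) + viaFresh i j k
      ≡⟨ cong (λ t → (isZero i j k + t) + viaFresh i j k) (sumBelow-remove m value (last-used s)) ⟩
    (isZero i j k + (sumBelow m value - value l)) + viaFresh i j k
      ≡⟨ cong (λ t → (isZero i j k + (t - value l)) + viaFresh i j k)
           (sumBelow-count m (λ r → via r i j k) refl (used s)) ⟩
    (isZero i j k + ((+ count 1 m rem * viaOne i j k + + count 2 m rem * viaTwo i j k) - value l)) + viaFresh i j k
      ≡⟨ cong₂ (λ a b → (isZero i j k + ((+ a * viaOne i j k + + b * viaTwo i j k) - value l)) + viaFresh i j k) (ones s) (twos s) ⟩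
    (isZero i j k + ((+ i * viaOne i j k + + j * viaTwo i j k) - value l)) + viaFresh i j k
      ≡⟨ lem (isZero i j k) (+ i * viaOne i j k) (+ j * viaTwo i j k) (value l) (viaFresh i j k) ⟩
    (isZero i j k + + i * viaOne i j k + + j * viaTwo i j k + viaFresh i j k) - value l
      ≡⟨ cong (_- value l) (sym (G-unfold i j k)) ⟩
    G i j k - value l ∎
    where open ≡-Reasoning

private
  old-⇔ : ∀ {m k l rem x r} → x ≢ l → rem x ≡ suc r → ∀ {w} → Run m k x (upd rem x r) w ⇔ Old m k l rem x w
  old-⇔ {m} {k} {rem = rem} {x} x≢l rem-x = mk⇔ (λ run → x≢l , _ , rem-x , run)
    λ (_ , r′ , rem-x′ , run) → subst (λ r → Run m k x (upd rem x r) _) (suc-injective (trans (sym rem-x′) rem-x)) run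

enum-old k j i s zero x x<m x≢l rem-x =
  enum-∅ λ { (_ , _ , rem-x′ , _) → contradiction (trans (sym rem-x) rem-x′) λ () }
enum-old k j zero {m} {rem = rem} s 1 x x<m x≢l rem-x = contradiction rem-x (count≡0⇒≢ 1 m rem (ones s) x<m)
enum-old k j (suc i) {m} {rem = rem} s 1 x x<m x≢l rem-x =
  enum-⇔ (old-⇔ x≢l rem-x) (subst (Enumeration _) value (enum-run k j i s′))
  where
  s′ : State m k x (upd rem x 0) i j
  s′ = state-old s x<m z≤n
    (suc-injective (trans (count-upd 1 m rem 0 x<m rem-x) (ones s)))
    (trans (count-upd 2 m rem 0 x<m rem-x) (twos s))
  lem : ∀ a → a - + 0 ≡ a
  lem = solve-∀
  -- The last copy of `x` has been read, so there is no repetition left to forbid.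
  value : G i j k - via (upd rem x 0 x) i j k ≡ viaOne (suc i) j k
  value rewrite upd-same rem x {0} = trans (lem (G i j k)) (sym (viaOne-suc i j k))
enum-old k zero i {m} {rem = rem} s 2 x x<m x≢l rem-x = contradiction rem-x (count≡0⇒≢ 2 m rem (twos s) x<m)
enum-old k (suc j) i {m} {rem = rem} s 2 x x<m x≢l rem-x =
  enum-⇔ (old-⇔ x≢l rem-x) (subst (Enumeration _) value (enum-run k j (suc i) s′))
  where
  s′ : State m k x (upd rem x 1) (suc i) j
  s′ = state-old s x<m (s≤s z≤n)
    (trans (count-upd 1 m rem 1 x<m rem-x) (cong suc (ones s)))
    (suc-injective (trans (count-upd 2 m rem 1 x<m rem-x) (twos s)))
  -- One copy of `x` remains and must not follow at once, hence the correction `viaOne (suc i) j k`.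
  value : G (suc i) j k - via (upd rem x 1 x) (suc i) j k ≡ viaTwo i (suc j) k
  value rewrite upd-same rem x {1} | viaOne-suc i j k = sym (viaTwo-suc i j k)
enum-old k j i s (suc (suc (suc r))) x x<m x≢l rem-x with subst (_≤ 2) rem-x (used s x<m)
... | s≤s (s≤s ())

enum-fresh zero j i s rewrite viaFresh-zero i j = enum-∅ λ { (_ , () , _) }
enum-fresh (suc k) j i {m} {rem = rem} s =
  enum-⇔ (mk⇔ (λ run → k , refl , 2 , rem-m , run)
              (λ { (_ , refl , r , rem-m′ , run) →
                 subst (λ r → Run (suc m) k m (upd rem m r) _) (suc-injective (trans (sym rem-m′) rem-m)) run }))
    (subst (Enumeration _) value (enum-run k (suc j) i (state-fresh s)))
  where
  rem-m : rem m ≡ 3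
  rem-m = unused s ≤-refl (subst (m <_) (sym (+-suc m k)) (s≤s (m≤m+n m k)))
  value : G i (suc j) k - via (upd rem m 2 m) i (suc j) k ≡ viaFresh i j (suc k)
  value rewrite upd-same rem m {2} | viaTwo-suc i j k = sym (viaFresh-suc i j k)

-- Boolean conditions as propositions.

-- The starting letter moves in the recursion, just as a `fresh` step moves `m` to `suc m`.
range : ℕ → ℕ → List ℕ
range m zero    = []
range m (suc k) = m ∷ range (suc m) k

applyUpTo-range : ∀ {f} m k → (∀ x → f x ≡ m +ℕ x) → applyUpTo f k ≡ range m k
applyUpTo-range m zero    f≡ = refl
applyUpTo-range m (suc k) f≡ =
  cong₂ _∷_ (trans (f≡ 0) (+-identityʳ m)) (applyUpTo-range (suc m) k λ x → trans (f≡ (suc x)) (+-suc m x))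

oneTo-range : ∀ n → oneTo n ≡ range 1 n
oneTo-range n = trans (map-upTo suc n) (applyUpTo-range 1 n λ _ → refl)

eqList⇒≡ : ∀ u v → T (eqList u v) → u ≡ v
eqList⇒≡ []      []      _ = refl
eqList⇒≡ (x ∷ u) (y ∷ v) t with to (T-∧ {x ≡ᵇ y}) t
... | x≡y , u≡v = cong₂ _∷_ (≡ᵇ⇒≡ x y x≡y) (eqList⇒≡ u v u≡v)

eqList-refl : ∀ u → T (eqList u u)
eqList-refl []      = _
eqList-refl (x ∷ u) rewrite ≡ᵇ-refl x = eqList-refl u

eqList-⇔ : ∀ {u v} → T (eqList u v) ⇔ u ≡ v
eqList-⇔ {u} {v} = mk⇔ (eqList⇒≡ u v) λ { refl → eqList-refl u }

occ-same : ∀ x w → occ x (x ∷ w) ≡ suc (occ x w)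
occ-same x w rewrite ≡ᵇ-refl x = refl

occ-other : ∀ {x y} w → y ≢ x → occ y (x ∷ w) ≡ occ y w
occ-other w y≢x rewrite ≢⇒≡ᵇ y≢x = refl

-- Bounds on the entries become vanishing occurrence counts, so the function `rem` can encode them
-- together with the multiplicities.
allB-occ⇒ : ∀ f w → T (allB f w) → ∀ x → ¬ T (f x) → occ x w ≡ 0
allB-occ⇒ f []      _ x ¬fx = refl
allB-occ⇒ f (y ∷ w) t x ¬fx with to (T-∧ {f y}) t
... | fy , fw with x ≟ y
...   | yes refl = contradiction fy ¬fx
...   | no  x≢y  = trans (occ-other w x≢y) (allB-occ⇒ f w fw x ¬fx)

occ⇒allB : ∀ f w → (∀ x → occ x w ≢ 0 → T (f x)) → T (allB f w)
occ⇒allB f []      h = _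
occ⇒allB f (y ∷ w) h = from (T-∧ {f y}) (h y (λ e → 1+n≢0 (trans (sym (occ-same y w)) e)) , occ⇒allB f w h′)
  where
  h′ : ∀ x → occ x w ≢ 0 → T (f x)
  h′ x x∈ with x ≟ y
  ... | yes refl = h x λ e → 1+n≢0 (trans (sym (occ-same x w)) e)
  ... | no  x≢y  = h x λ e → x∈ (trans (sym (occ-other w x≢y)) e)

allB-range⇒ : ∀ f m k → T (allB f (range m k)) → ∀ x → m ≤ x → x < m +ℕ k → T (f x)
allB-range⇒ f m zero    _ x m≤x x<m+0 = contradiction (subst (x <_) (+-identityʳ m) x<m+0) (≤⇒≯ m≤x)
allB-range⇒ f m (suc k) t x m≤x x<m+k with to (T-∧ {f m}) t | m≤n⇒m<n∨m≡n m≤x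
... | fm , fr | inj₁ m<x  = allB-range⇒ f (suc m) k fr x m<x (subst (x <_) (+-suc m k) x<m+k)
... | fm , fr | inj₂ refl = fm

⇒allB-range : ∀ f m k → (∀ x → m ≤ x → x < m +ℕ k → T (f x)) → T (allB f (range m k))
⇒allB-range f m zero    h = _
⇒allB-range f m (suc k) h = from (T-∧ {f m})
  ( h m ≤-refl (subst (m <_) (sym (+-suc m k)) (s≤s (m≤m+n m k)))
  , ⇒allB-range f (suc m) k λ x m<x x< → h x (<⇒≤ m<x) (subst (x <_) (sym (+-suc m k)) x<) )

-- Runs and the defining conditions of words.

-- Prepending `l` makes the Carlitz condition cover the junction with the prefix, and `seen` lets
-- first occurrences be judged from the middle of a word.
record Spec (seen : List ℕ) (m k l : ℕ) (rem : ℕ → ℕ) (w : List ℕ) : Set where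
  constructor spec
  field
    carlitz : T (isCarlitz (l ∷ w))
    ordered : firstOccsFrom seen w ≡ range m k
    occurs  : ∀ x → occ x w ≡ rem x

-- Restricted to letters still to come, since the sentinel 0 counts as used
-- without having been read.
Seen : List ℕ → ℕ → (ℕ → ℕ) → Set
Seen seen m rem = ∀ x → rem x ≢ 0 → T (memberB x seen) ⇔ x < m

seen-old : ∀ {seen m rem x r} → rem x ≡ suc r → Seen seen m rem → Seen seen m (upd rem x r)
seen-old {rem = rem} {x} {r} rem-x seen-ok y rem-y = seen-ok y (rem-y≢0 rem-y)
  where
  rem-y≢0 : upd rem x r y ≢ 0 → rem y ≢ 0
  rem-y≢0 h with y ≟ x
  ... | yes refl = λ e → 1+n≢0 (trans (sym rem-x) e)
  ... | no  y≢x  = h ∘ trans (upd-other rem y≢x)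

seen-fresh : ∀ {seen m rem r} → rem m ≡ suc r → Seen seen m rem → Seen (m ∷ seen) (suc m) (upd rem m r)
seen-fresh {seen} {m} {rem} {r} rem-m seen-ok y rem-y = mk⇔ fwd bwd
  where
  seen-y : T (memberB y seen) ⇔ y < m
  seen-y = seen-old {seen} {m} rem-m seen-ok y rem-y
  fwd : T ((y ≡ᵇ m) ∨ memberB y seen) → y < suc m
  fwd t with to (T-∨ {y ≡ᵇ m}) t
  ... | inj₁ y≡m = s≤s (≤-reflexive (≡ᵇ⇒≡ y m y≡m))
  ... | inj₂ y∈  = m<n⇒m<1+n (to seen-y y∈)
  bwd : y < suc m → T ((y ≡ᵇ m) ∨ memberB y seen)
  bwd y<1+m with m<1+n⇒m<n∨m≡n y<1+m
  ... | inj₁ y<m  = from (T-∨ {y ≡ᵇ m}) (inj₂ (from seen-y y<m))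
  ... | inj₂ refl = from (T-∨ {y ≡ᵇ m}) (inj₁ (≡⇒≡ᵇ y y refl))

occurs-tail : ∀ {rem x} w → (∀ y → occ y (x ∷ w) ≡ rem y) → ∀ y → occ y w ≡ upd rem x (occ x w) y
occurs-tail {rem} {x} w occurs y with y ≟ x
... | yes refl = sym (upd-same rem y)
... | no  y≢x  = trans (sym (occ-other w y≢x)) (trans (occurs y) (sym (upd-other rem y≢x)))

occurs-cons : ∀ {rem x r} w → rem x ≡ suc r → (∀ y → occ y w ≡ upd rem x r y) → ∀ y → occ y (x ∷ w) ≡ rem y
occurs-cons {rem} {x} {r} w rem-x occurs y with y ≟ x
... | yes refl = trans (occ-same y w) (trans (cong suc (trans (occurs y) (upd-same rem y))) (sym rem-x))
... | no  y≢x  = trans (occ-other w y≢x) (trans (occurs y) (upd-other rem y≢x))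

-- Membership of the next letter in `seen` decides between `old` and `fresh`. That letter is still
-- owed, as it occurs here, so `Seen` applies to it.
spec⇒run : ∀ {seen m k l rem} w → Seen seen m rem → Spec seen m k l rem w → Run m k l rem w
spec⇒run {k = zero}  []      seen-ok (spec _ _ occurs) = done (sym ∘ occurs)
spec⇒run {k = suc k} []      seen-ok (spec _ () _)
spec⇒run {seen} {m} {k} {l} {rem} (x ∷ w) seen-ok (spec carlitz ordered occurs)
  with to (T-∧ {not (l ≡ᵇ x)}) carlitz | memberB x seen in x∈?seen
... | x≢l , carlitz′ | true =
  old (to (seen-ok x rem-x≢0) (from T-≡ x∈?seen)) (λ { refl → subst (T ∘ not) (≡ᵇ-refl x) x≢l }) rem-x
    (spec⇒run w (seen-old {seen} {m} rem-x seen-ok) (spec carlitz′ ordered (occurs-tail w occurs)))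
  where
  rem-x : rem x ≡ suc (occ x w)
  rem-x = trans (sym (occurs x)) (occ-same x w)
  rem-x≢0 : rem x ≢ 0
  rem-x≢0 e = 1+n≢0 (trans (sym rem-x) e)
spec⇒run {k = zero} (x ∷ w) seen-ok (spec carlitz () occurs) | _ | false
spec⇒run {seen} {m} {suc k} {rem = rem} (x ∷ w) seen-ok (spec carlitz ordered occurs) | _ , carlitz′ | false
  -- An unseen letter heads the list of first occurrences, and the order condition forces it to be
  -- `m`.
  with refl , ordered′ ← ∷-injective ordered =
  fresh rem-x (spec⇒run w (seen-fresh {seen} rem-x seen-ok) (spec carlitz′ ordered′ (occurs-tail w occurs)))
  where
  rem-x : rem x ≡ suc (occ x w)
  rem-x = trans (sym (occurs x)) (occ-same x w)

carlitz-cons : ∀ {l x w} → x ≢ l → T (isCarlitz (x ∷ w)) → T (isCarlitz (l ∷ x ∷ w))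
carlitz-cons x≢l carlitz rewrite ≢⇒≡ᵇ (x≢l ∘ sym) = carlitz

run⇒spec : ∀ {seen m k l rem w} → l < m → Seen seen m rem → Run m k l rem w → Spec seen m k l rem w
run⇒spec l<m seen-ok (done rem≡0) = spec _ refl (sym ∘ rem≡0)
run⇒spec {seen} {m} {rem = rem} l<m seen-ok (old {x = x} {w = w} x<m x≢l rem-x run)
  with run⇒spec x<m (seen-old {seen} {m} rem-x seen-ok) run
... | spec carlitz ordered occurs =
  spec (carlitz-cons {w = w} x≢l carlitz) ordered′ (occurs-cons w rem-x occurs)
  where
  ordered′ : firstOccsFrom seen (x ∷ w) ≡ range m _
  ordered′ rewrite to T-≡ (from (seen-ok x λ e → 1+n≢0 (trans (sym rem-x) e)) x<m) = ordered
run⇒spec {seen} {m} {suc k} {l} l<m seen-ok (fresh {w = w} rem-m run)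
  with run⇒spec ≤-refl (seen-fresh {seen} rem-m seen-ok) run
... | spec carlitz ordered occurs =
  -- The previous letter lies below `m`, so a fresh letter cannot repeat it; this is why `fresh`
  -- carries no inequality.
  spec (carlitz-cons {l} {w = w} (<⇒≢ l<m ∘ sym) carlitz) ordered′ (occurs-cons w rem-m occurs)
  where
  ordered′ : firstOccsFrom seen (m ∷ w) ≡ range m (suc k)
  ordered′ with memberB m seen in m∈?seen
  ... | false = cong (m ∷_) ordered
  ... | true  = contradiction (to (seen-ok m λ e → 1+n≢0 (trans (sym rem-m) e)) (from T-≡ m∈?seen)) (<-irrefl refl)

-- The state after a leading 0: for c = 1 the 0 begins a word of 0², 1³, ..., n³;
-- for c = 0 it is a sentinel placed in front of a word of 1³, ..., n³.
letters : ℕ → ℕ → ℕ → ℕ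
letters c n zero    = c
letters c n (suc x) = if x <ᵇ n then 3 else 0

letters-in : ∀ c {n x} → 1 ≤ x → x < 1 +ℕ n → letters c n x ≡ 3
letters-in c {n} {suc x} _ (s≤s x<n) rewrite to T-≡ (<⇒<ᵇ x<n) = refl

letters-out : ∀ c {n x} → n < x → letters c n x ≡ 0
letters-out c {n} {suc x} (s≤s n≤x) with x <ᵇ n in eq
... | true  = contradiction (<ᵇ⇒< x n (from T-≡ eq)) (≤⇒≯ n≤x)
... | false = refl

-- The words of the theorem as runs.

-- The only letter below 1 is 0, with `c` copies left, so both counts are read off from `c`.
initial : ∀ n c {i j} → c ≤ 2 → count 1 1 (letters c n) ≡ i → count 2 1 (letters c n) ≡ j →
  State 1 n 0 (letters c n) i j
initial n c c≤2 ones twos = record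
  { last-used = s≤s z≤n ; used = λ { (s≤s z≤n) → c≤2 } ; unused = letters-in c ; absent = letters-out c
  ; ones = ones ; twos = twos }

occ≡letters : ∀ c n w → occ 0 w ≡ c → (∀ x → 1 ≤ x → x < 1 +ℕ n → occ x w ≡ 3) → (∀ x → n < x → occ x w ≡ 0) →
  ∀ x → occ x w ≡ letters c n x
occ≡letters c n w zeros threes none zero    = zeros
occ≡letters c n w zeros threes none (suc x) with x <? n
... | yes x<n = trans (threes (suc x) (s≤s z≤n) (s≤s x<n)) (sym (letters-in c (s≤s z≤n) (s≤s x<n)))
... | no  x≮n = trans (none (suc x) (s≤s (≮⇒≥ x≮n))) (sym (letters-out c (s≤s (≮⇒≥ x≮n))))

letters≢0⇒≤ : ∀ c n x → letters c n x ≢ 0 → x ≤ n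
letters≢0⇒≤ c n x x∈ with x ≤? n
... | yes x≤n = x≤n
... | no  x≰n = contradiction (letters-out c (≰⇒> x≰n)) x∈

isWord3-⇔ : ∀ n w → T (isWord3 n w) ⇔ (∀ x → occ x w ≡ letters 0 n x)
isWord3-⇔ n w rewrite oneTo-range n = mk⇔ fwd bwd
  where
  inRange : ℕ → Bool
  inRange x = (1 ≤ᵇ x) ∧ (x ≤ᵇ n)
  fwd : T (allB inRange w ∧ allB (λ i → occ i w ≡ᵇ 3) (range 1 n)) → ∀ x → occ x w ≡ letters 0 n x
  fwd t with to (T-∧ {allB inRange w}) t
  ... | all-in , all-3 = occ≡letters 0 n w (allB-occ⇒ inRange w all-in 0 id)
    (λ x 1≤x x<1+n → ≡ᵇ⇒≡ _ _ (allB-range⇒ _ 1 n all-3 x 1≤x x<1+n))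
    (λ x n<x → allB-occ⇒ inRange w all-in x λ t → <⇒≱ n<x (≤ᵇ⇒≤ x n (proj₂ (to (T-∧ {1 ≤ᵇ x}) t))))
  bwd : (∀ x → occ x w ≡ letters 0 n x) → T (allB inRange w ∧ allB (λ i → occ i w ≡ᵇ 3) (range 1 n))
  bwd occurs = from (T-∧ {allB inRange w})
    ( occ⇒allB inRange w in-range
    , ⇒allB-range _ 1 n λ x 1≤x x<1+n → ≡⇒≡ᵇ _ _ (trans (occurs x) (letters-in 0 1≤x x<1+n)) )
    where
    in-range : ∀ x → occ x w ≢ 0 → T (inRange x)
    in-range zero    x∈ = contradiction (occurs 0) x∈
    in-range (suc x) x∈ = ≤⇒≤ᵇ (letters≢0⇒≤ 0 n (suc x) (x∈ ∘ trans (occurs (suc x))))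

isWord03-⇔ : ∀ n w → T (isWord03 n (0 ∷ w)) ⇔ (∀ x → occ x w ≡ letters 1 n x)
isWord03-⇔ n w rewrite oneTo-range n = mk⇔ fwd bwd
  where
  threes : ℕ → Bool
  threes i = occ i (0 ∷ w) ≡ᵇ 3
  occ-0∷ : ∀ {x} → 1 ≤ x → occ x (0 ∷ w) ≡ occ x w
  occ-0∷ (s≤s _) = refl
  fwd : T (allB (_≤ᵇ n) w ∧ (suc (occ 0 w) ≡ᵇ 2) ∧ allB threes (range 1 n)) → ∀ x → occ x w ≡ letters 1 n x
  fwd t with to (T-∧ {allB (_≤ᵇ n) w}) t
  ... | all-≤ , t′ with to (T-∧ {suc (occ 0 w) ≡ᵇ 2}) t′
  ...   | zeros , all-3 = occ≡letters 1 n w (≡ᵇ⇒≡ _ 1 zeros)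
    (λ x 1≤x x<1+n → trans (sym (occ-0∷ 1≤x)) (≡ᵇ⇒≡ _ _ (allB-range⇒ threes 1 n all-3 x 1≤x x<1+n)))
    (λ x n<x → allB-occ⇒ (_≤ᵇ n) w all-≤ x λ t → <⇒≱ n<x (≤ᵇ⇒≤ x n t))
  bwd : (∀ x → occ x w ≡ letters 1 n x) → T (allB (_≤ᵇ n) w ∧ (suc (occ 0 w) ≡ᵇ 2) ∧ allB threes (range 1 n))
  bwd occurs = from (T-∧ {allB (_≤ᵇ n) w})
    ( occ⇒allB (_≤ᵇ n) w (λ x x∈ → ≤⇒≤ᵇ (letters≢0⇒≤ 1 n x (x∈ ∘ trans (occurs x))))
    , from (T-∧ {suc (occ 0 w) ≡ᵇ 2})
        ( ≡⇒≡ᵇ _ 1 (occurs 0)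
        , ⇒allB-range threes 1 n λ x 1≤x x<1+n → ≡⇒≡ᵇ _ _ (trans (occ-0∷ 1≤x) (trans (occurs x) (letters-in 1 1≤x x<1+n))) ) )

word3-⇔ : ∀ {n w} → Run 1 n 0 (letters 0 n) w ⇔ T (OrderedCarlitzWord n w)
word3-⇔ {n} {w} = mk⇔ fwd bwd
  where
  seen-ok : Seen [] 1 (letters 0 n)
  seen-ok zero    0∈ = contradiction refl 0∈
  seen-ok (suc x) _  = mk⇔ (λ ()) λ { (s≤s ()) }
  drop-0 : ∀ w → T (isCarlitz (0 ∷ w)) → T (isCarlitz w)
  drop-0 []      _ = _
  drop-0 (x ∷ w) t = proj₂ (to (T-∧ {not (0 ≡ᵇ x)}) t)
  -- A word without 0 cannot clash with the sentinel in front of it.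
  cons-0 : ∀ w → occ 0 w ≡ 0 → T (isCarlitz w) → T (isCarlitz (0 ∷ w))
  cons-0 []          _ _ = _
  cons-0 (suc x ∷ w) _ t = t
  fwd : Run 1 n 0 (letters 0 n) w → T (OrderedCarlitzWord n w)
  fwd run with run⇒spec (s≤s z≤n) seen-ok run
  ... | spec carlitz ordered occurs = from (T-∧ {isWord3 n w})
    ( from (isWord3-⇔ n w) occurs
    , from (T-∧ {isCarlitz w}) (drop-0 w carlitz , from eqList-⇔ (trans ordered (sym (oneTo-range n)))) )
  bwd : T (OrderedCarlitzWord n w) → Run 1 n 0 (letters 0 n) w
  bwd t with to (T-∧ {isWord3 n w}) t
  ... | word , t′ with to (T-∧ {isCarlitz w}) t′
  ...   | carlitz , ordered = spec⇒run w seen-ok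
    (spec (cons-0 w (occurs 0) carlitz) (trans (to eqList-⇔ ordered) (oneTo-range n)) occurs)
    where
    occurs : ∀ x → occ x w ≡ letters 0 n x
    occurs = to (isWord3-⇔ n w) word

-- Here the leading 0 belongs to the word and one copy of it is still to come, hence `Cons 0` and
-- `letters 1 n`.
word03-⇔ : ∀ {n w} → Cons 0 (Run 1 n 0 (letters 1 n)) w ⇔ T (OrderedCarlitzWord0 n w)
word03-⇔ {n} = mk⇔ fwd (bwd _)
  where
  seen-ok : Seen (0 ∷ []) 1 (letters 1 n)
  seen-ok zero    _ = mk⇔ (λ _ → s≤s z≤n) _
  seen-ok (suc x) _ = mk⇔ (λ ()) λ { (s≤s ()) }
  fwd : ∀ {w} → Cons 0 (Run 1 n 0 (letters 1 n)) w → T (OrderedCarlitzWord0 n w)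
  fwd (cons {w} run) with run⇒spec (s≤s z≤n) seen-ok run
  ... | spec carlitz ordered occurs = from (T-∧ {isWord03 n (0 ∷ w)})
    ( from (isWord03-⇔ n w) occurs
    , from (T-∧ {isCarlitz (0 ∷ w)}) (carlitz , from eqList-⇔ (trans ordered (sym (oneTo-range n)))) )
  bwd : ∀ w → T (OrderedCarlitzWord0 n w) → Cons 0 (Run 1 n 0 (letters 1 n)) w
  bwd w t with to (T-∧ {isWord03 n w}) t
  ... | word , t′ with w | to (T-∧ {isCarlitz w}) t′
  -- `isOrdered0` rejects the empty word and every nonzero head; after a head 0 it reduces to the
  -- order condition on the tail with 0 already seen.
  ...   | zero ∷ w | carlitz , ordered = cons (spec⇒run w seen-ok
    (spec carlitz (trans (to eqList-⇔ ordered) (oneTo-range n)) (to (isWord03-⇔ n w) word)))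

-- The counts of the ordered Carlitz words.

enum-word3 : ∀ n → Enumeration (λ w → T (OrderedCarlitzWord n w)) (P n)
enum-word3 n = enum-⇔ word3-⇔ (subst (Enumeration _) (lem (P n)) (enum-run n 0 0 (initial n 0 z≤n refl refl)))
  where
  lem : ∀ a → a - + 0 ≡ a
  lem = solve-∀

enum-word03 : ∀ n → Enumeration (λ w → T (OrderedCarlitzWord0 n w)) (Q n)
enum-word03 n = enum-⇔ word03-⇔ (enum-cons 0
  -- The correction for the leading 0, which has one copy left, turns `G 1 0 n` into `Q n`.
  (subst (Enumeration _) (cong (G 1 0 n -_) (viaOne-suc 0 0 n)) (enum-run n 0 1 (initial n 1 (s≤s z≤n) refl refl))))

theorem3p2 : (p q : ℕ → ℤ) →
    p 0 ≡ + 1 → p 1 ≡ + 0 → q 0 ≡ + 0 →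
    (∀ n → + 2 * p (suc (suc n))
    ≡ (+ (3 *ℕ suc n +ℕ 3)) * q (suc n) - (+ 2) * (+ (3 *ℕ suc n +ℕ 1)) * p (suc n) + (+ 2) * p n) →
    (∀ n → q (suc n) ≡ (+ (3 *ℕ suc n +ℕ 2)) * p (suc n) + (+ 2) * q n) →
    ∀ n →
    (∃ λ k → (Fin k ↔ Σ (List ℕ) (λ w → T (OrderedCarlitzWord n w))) × p n ≡ + k)
    × (∃ λ k → (Fin k ↔ Σ (List ℕ) (λ w → T (OrderedCarlitzWord0 n w))) × q n ≡ + k)
theorem3p2 p q p₀ p₁ q₀ p-rec q-rec n
  with pₙ , _ , qₙ ← recurrence-unique p q p₀ p₁ q₀ p-rec q-rec n
  rewrite pₙ | qₙ = enum-↔ (enum-word3 n) , enum-↔ (enum-word03 n)
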